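{- Let $v_1=(x_1,y_1)$ and $v_2=(x_2,y_2)$ be distinct points of $A_2$, let $d\ge d^{\rm hex}(v_1,v_2)$ be an integer, $c=d-d^{\rm hex}(v_1,v_2)$, and let ${\cal A}_d(v_1,v_2)$ be the optimal tristance anticode in the hexagonal graph of diameter $d$ centered about $v_1$ and $v_2$. Then ${\cal A}_d(v_1,v_2)$ consists of all $(x,y)\in A_2$ such that $\min\{x_1,x_2\}-c\le x\le\max\{x_1,x_2\}+c$, $\min\{y_1,y_2\}-c\le y\le\max\{y_1,y_2\}+c$, $\min\{x_1-y_1,x_2-y_2\}-c\le x-y\le\max\{x_1-y_1,x_2-y_2\}+c$.
   Context: Let $\omega=-\tfrac12+\tfrac{\sqrt3}{2}i$. The hexagonal lattice is $A_2=\{x+\omega y: x,y\in\mathbb{Z}\}$, and the point $x+\omega y$ is written $(x,y)$. The hexagonal graph has vertex set $A_2$, two points being adjacent iff their Euclidean distance (in $\mathbb{C}$) is $1$; equivalently $(x,y)$ is adjacent to $(x\pm1,y)$, $(x,y\pm1)$, $(x+1,y+1)$, $(x-1,y-1)$. $d^{\rm hex}$ denotes the graph distance and $d^{\rm hex}_3(v_1,v_2,v_3)$ the tristance: the minimum number of edges of a tree in the hexagonal graph (possibly using additional vertices) containing $v_1,v_2,v_3$. A set ${\cal A}\subset A_2$ is a tristance anticode of diameter $d$ centered about $v_1,v_2$ if $d^{\rm hex}_3(v_1,v_2,v)\le d$ for all $v\in{\cal A}$; it is optimal if it has largest possible cardinality among such sets. -}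

module Defs where

open import Data.Nat using (ℕ; zero; suc; _≤_)
open import Data.Integer as ℤ using (ℤ; +_; _-_; _⊓_; _⊔_)
import Data.Integer as Z
open import Data.Product using (_×_; _,_; Σ; ∃; ∃-syntax)
open import Data.List using (List; []; _∷_; [_]; length)
open import Data.List.Membership.Propositional using (_∈_; _∉_)
open import Data.List.Relation.Unary.All using (All)
open import Data.List.Relation.Unary.Unique.Propositional using (Unique)
open import Relation.Binary.PropositionalEquality using (_≡_)

-- The point x + ω y of A₂ is written (x , y).
Pt : Set
Pt = ℤ × ℤ

data Adj : Pt → Pt → Set where
  e₁ : ∀ x y → Adj (x , y) (x Z.+ + 1 , y)
  e₂ : ∀ x y → Adj (x , y) (x Z.- + 1 , y)
  e₃ : ∀ x y → Adj (x , y) (x , y Z.+ + 1)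
  e₄ : ∀ x y → Adj (x , y) (x , y Z.- + 1)
  e₅ : ∀ x y → Adj (x , y) (x Z.+ + 1 , y Z.+ + 1)
  e₆ : ∀ x y → Adj (x , y) (x Z.- + 1 , y Z.- + 1)

data Walk : Pt → Pt → ℕ → Set where
  here : ∀ u → Walk u u 0
  step : ∀ {u v w n} → Adj u v → Walk v w n → Walk u w (suc n)

IsDist : Pt → Pt → ℕ → Set
IsDist u v k = Walk u v k × (∀ n → Walk u v n → k ≤ n)

-- Finite trees in the hexagonal graph, given by their vertex list and
-- number of edges, built by repeatedly attaching a new leaf.
data Tree : List Pt → ℕ → Set where
  single : ∀ v → Tree [ v ] 0
  grow   : ∀ {vs n u w} → Tree vs n → u ∈ vs → Adj u w → w ∉ vs → Tree (w ∷ vs) (suc n)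

TreeThrough : Pt → Pt → Pt → ℕ → Set
TreeThrough v₁ v₂ v₃ m = ∃[ vs ] (Tree vs m × v₁ ∈ vs × v₂ ∈ vs × v₃ ∈ vs)

IsTristance : Pt → Pt → Pt → ℕ → Set
IsTristance v₁ v₂ v₃ k = TreeThrough v₁ v₂ v₃ k × (∀ m → TreeThrough v₁ v₂ v₃ m → k ≤ m)

IsAnticode : ℕ → Pt → Pt → List Pt → Set
IsAnticode d v₁ v₂ A = Unique A × All (λ v → ∃[ k ] (IsTristance v₁ v₂ v k × k ≤ d)) A

IsOptimalAnticode : ℕ → Pt → Pt → List Pt → Set
IsOptimalAnticode d v₁ v₂ A =
  IsAnticode d v₁ v₂ A × (∀ B → IsAnticode d v₁ v₂ B → length B ≤ length A)

InRegion : ℕ → Pt → Pt → Pt → Set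
InRegion c (x₁ , y₁) (x₂ , y₂) (x , y) =
  ((x₁ ⊓ x₂) - + c Z.≤ x × x Z.≤ (x₁ ⊔ x₂) Z.+ + c) ×
  ((y₁ ⊓ y₂) - + c Z.≤ y × y Z.≤ (y₁ ⊔ y₂) Z.+ + c) ×
  (((x₁ - y₁) ⊓ (x₂ - y₂)) - + c Z.≤ x - y × x - y Z.≤ ((x₁ - y₁) ⊔ (x₂ - y₂)) Z.+ + c)

{-# OPTIONS --safe #-}
module Submission where

-- A tree containing three points contains a vertex w joined to them by walks of
-- total length at most its number of edges, so the tristance is the least value
-- of d(w,v₁) + d(w,v₂) + d(w,v).  In the 60° sector containing v₂ − v₁ the
-- distance k = d(v₁,v₂) is linear, which makes d(w,v₁) + d(w,v₂) exceed k by at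
-- least the amount by which w violates any half-plane bounding the hexagon of
-- geodesics from v₁ to v₂; hence v lies in that hexagon enlarged by m − k
-- whenever a tree with m edges contains v₁, v₂, v.  Conversely a point of the
-- hexagon enlarged by c + 1 has a neighbour in (or lies in) the one enlarged by
-- c, so c steps lead to a point w on a geodesic.  The points v of tristance at most
-- d thus form a finite set, and the optimal anticode is the whole of it.

open import Defs
open import Data.Nat using (ℕ; _≤_; _∸_)
open import Data.Product using (_×_; Σ; ∃-syntax)
open import Data.List using (List)
open import Data.List.Membership.Propositional using (_∈_)
open import Function.Bundles using (_⇔_)
open import Relation.Binary.PropositionalEquality using (_≢_)

open import Data.Nat using (zero; suc; z≤n; s≤s)
import Data.Nat as ℕ
import Data.Nat.Properties as ℕ
open import Data.Integer using (ℤ; +_; _+_; _-_; -_; _⊔_; _⊓_; ∣_∣)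
  renaming (_≤_ to _≤ᶻ_; _≤?_ to _≤ᶻ?_)
import Data.Integer as ℤ
import Data.Integer.Properties as ℤ
open import Data.Integer.Tactic.RingSolver using (solve)
open import Data.Fin using (Fin; zero; suc)
open import Data.Fin.Patterns using (0F; 1F; 2F; 3F; 4F; 5F)
open import Data.Fin.Properties using (all?; ¬∀⟶∃¬; injective⇒≤)
open import Data.Product using (_,_; proj₁; proj₂)
open import Data.Product.Properties using (≡-dec)
open import Data.Sum using (_⊎_; inj₁; inj₂)
open import Data.Empty using (⊥-elim)
open import Data.List using ([]; _∷_; length; lookup; map; upTo; filter; cartesianProduct)
open import Data.List.Membership.Propositional.Properties
  using (∈-lookup; ∈-map⁺; ∈-upTo⁺; ∈-filter⁺; ∈-filter⁻; ∈-cartesianProduct⁺)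
import Data.List.Membership.DecPropositional as DecMembership
open import Data.List.Relation.Unary.All as All using (All)
open import Data.List.Relation.Unary.All.Properties using (¬Any⇒All¬)
open import Data.List.Relation.Unary.AllPairs using (_∷_)
open import Data.List.Relation.Unary.Any using (here; there; index)
open import Data.List.Relation.Unary.Any.Properties using (lookup-index)
open import Data.List.Relation.Binary.Subset.Propositional using (_⊆_)
open import Data.List.Relation.Unary.Unique.Propositional using (Unique)
import Data.List.Relation.Unary.Unique.Propositional.Properties as Unique
open import Function using (_∘_; _∋_)
open import Function.Bundles using (mk⇔)
open import Relation.Nullary using (¬_; Dec; yes; no)
open import Relation.Binary.PropositionalEquality
  using (_≡_; refl; sym; trans; cong; cong₂; subst; subst₂)

-- Linear arithmetic over the integers.

infixl 5 _⊕_

_⊕_ : ∀ {a b c d} → a ≤ᶻ b → c ≤ᶻ d → a + c ≤ᶻ b + d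
_⊕_ = ℤ.+-mono-≤

-- Farkas certificates: an inequality follows from a sum of hypotheses with
-- the same slack, the equality of slacks being left to the ring solver.
-- Abstract, so that ring-solver proofs are never evaluated.
abstract
  linear : ∀ {a b c d} → a ≤ᶻ b → b - a ≡ d - c → c ≤ᶻ d
  linear p e = ℤ.0≤i-j⇒j≤i (subst (+ 0 ≤ᶻ_) e (ℤ.i≤j⇒0≤j-i p))

+-cancelˡ-≤ : ∀ a {m n} → a + + m ≤ᶻ a + + n → m ≤ n
+-cancelˡ-≤ a {m} {n} p = ℤ.drop‿+≤+ (lemma a (+ m) (+ n) p)
  where
  lemma : ∀ a b c → a + b ≤ᶻ a + c → b ≤ᶻ c
  lemma a b c p = linear p (solve (a ∷ b ∷ c ∷ []))

≡⇒≤ : ∀ {a b : ℤ} → a ≡ b → a ≤ᶻ b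
≡⇒≤ = ℤ.≤-reflexive

0≤+ : ∀ n → + 0 ≤ᶻ + n
0≤+ n = ℤ.+≤+ z≤n

≰⇒1+≤ : ∀ {a b} → ¬ a ≤ᶻ b → + 1 + b ≤ᶻ a
≰⇒1+≤ = ℤ.i<j⇒suc[i]≤j ∘ ℤ.≰⇒>

≤⇒∃ : ∀ {a b} → a ≤ᶻ b → ∃[ n ] b ≡ a + + n
≤⇒∃ {a} {b} a≤b = ∣ b - a ∣ , trans (lemma a b)
    (cong (λ z → a + z) (sym (ℤ.0≤i⇒+∣i∣≡i (ℤ.i≤j⇒0≤j-i a≤b))))
  where
  lemma : ∀ a b → b ≡ a + (b - a)
  lemma a b = solve (a ∷ b ∷ [])

-- Six directions and their functionals.

-- The six functionals φ i, in cyclic order, are the coordinates x, x − y, −y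
-- and their negatives; a hexagon is an intersection of six half-planes φ i ≤ h.
Dir : Set
Dir = Fin 6

next : Dir → Dir
next 0F = 1F
next 1F = 2F
next 2F = 3F
next 3F = 4F
next 4F = 5F
next 5F = 0F

next² next³ next⁴ next⁵ : Dir → Dir
next² i = next (next i)
next³ i = next (next (next i))
next⁴ i = next (next (next (next i)))
next⁵ i = next (next (next (next (next i))))

next⁶≡id : ∀ i → next (next⁵ i) ≡ i
next⁶≡id 0F = refl
next⁶≡id 1F = refl
next⁶≡id 2F = refl
next⁶≡id 3F = refl
next⁶≡id 4F = refl
next⁶≡id 5F = refl

cases : ∀ {P : Dir → Set} → P 0F → P 1F → P 2F → P 3F → P 4F → P 5F → ∀ i → P i
cases p q r s t u 0F = p
cases p q r s t u 1F = q
cases p q r s t u 2F = r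
cases p q r s t u 3F = s
cases p q r s t u 4F = t
cases p q r s t u 5F = u

-- Names the directions relative to `i`, so that one argument serves all six rotations.
around : ∀ {P : Dir → Set} i →
  P i → P (next i) → P (next² i) → P (next³ i) → P (next⁴ i) → P (next⁵ i) → ∀ j → P j
around 0F p q r s t u = cases p q r s t u
around 1F p q r s t u = cases u p q r s t
around 2F p q r s t u = cases t u p q r s
around 3F p q r s t u = cases s t u p q r
around 4F p q r s t u = cases r s t u p q
around 5F p q r s t u = cases q r s t u p

φ : Dir → Pt → ℤ
φ 0F (x , y) = x
φ 1F (x , y) = x - y
φ 2F (x , y) = - y
φ 3F (x , y) = - x
φ 4F (x , y) = y - x
φ 5F (x , y) = y

φ-next : ∀ i v → φ (next i) v ≡ φ i v + φ (next² i) v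
φ-next 0F (x , y) = refl
φ-next 1F (x , y) = (- y ≡ x - y + - x) ∋ solve (x ∷ y ∷ [])
φ-next 2F (x , y) = (- x ≡ - y + (y - x)) ∋ solve (x ∷ y ∷ [])
φ-next 3F (x , y) = (y - x ≡ - x + y) ∋ solve (x ∷ y ∷ [])
φ-next 4F (x , y) = (y ≡ y - x + x) ∋ solve (x ∷ y ∷ [])
φ-next 5F (x , y) = (x ≡ y + (x - y)) ∋ solve (x ∷ y ∷ [])

φ-opposite : ∀ i v → φ (next³ i) v ≡ - φ i v
φ-opposite 0F (x , y) = refl
φ-opposite 1F (x , y) = (y - x ≡ - (x - y)) ∋ solve (x ∷ y ∷ [])
φ-opposite 2F (x , y) = (y ≡ - - y) ∋ solve (y ∷ [])
φ-opposite 3F (x , y) = (x ≡ - - x) ∋ solve (x ∷ [])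
φ-opposite 4F (x , y) = (x - y ≡ - (y - x)) ∋ solve (x ∷ y ∷ [])
φ-opposite 5F (x , y) = refl

φ-opposite-≤ : ∀ i u v n → φ i u ≤ᶻ φ i v + n → φ (next³ i) v ≤ᶻ φ (next³ i) u + n
φ-opposite-≤ i u v n p = lemma (φ i u) (φ i v) n p (φ-opposite i u) (φ-opposite i v)
  where
  lemma : ∀ a b n {a′ b′} → a ≤ᶻ b + n → a′ ≡ - a → b′ ≡ - b → b′ ≤ᶻ a′ + n
  lemma a b n p refl refl = linear p (solve (a ∷ b ∷ n ∷ []))

-- Edges as unit shifts.

-- Along this edge φ i and φ (next i) decrease, next² i and next⁵ i being level.
shift : Dir → Pt → Pt
shift 0F (x , y) = x - + 1 , y
shift 1F (x , y) = x , y + + 1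
shift 2F (x , y) = x + + 1 , y + + 1
shift 3F (x , y) = x + + 1 , y
shift 4F (x , y) = x , y - + 1
shift 5F (x , y) = x - + 1 , y - + 1

shift-adj : ∀ i v → Adj v (shift i v)
shift-adj 0F (x , y) = e₂ x y
shift-adj 1F (x , y) = e₃ x y
shift-adj 2F (x , y) = e₅ x y
shift-adj 3F (x , y) = e₁ x y
shift-adj 4F (x , y) = e₄ x y
shift-adj 5F (x , y) = e₆ x y

adj⇒shift : ∀ {u v} → Adj u v → ∃[ i ] v ≡ shift i u
adj⇒shift (e₁ x y) = 3F , refl
adj⇒shift (e₂ x y) = 0F , refl
adj⇒shift (e₃ x y) = 1F , refl
adj⇒shift (e₄ x y) = 4F , refl
adj⇒shift (e₅ x y) = 2F , refl
adj⇒shift (e₆ x y) = 5F , refl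

adj-sym : ∀ {u v} → Adj u v → Adj v u
adj-sym = λ where
    (e₁ x y) → subst (λ z → Adj (x + + 1 , y) (z , y)) (up-down x) (e₂ _ _)
    (e₂ x y) → subst (λ z → Adj (x - + 1 , y) (z , y)) (down-up x) (e₁ _ _)
    (e₃ x y) → subst (λ z → Adj (x , y + + 1) (x , z)) (up-down y) (e₄ _ _)
    (e₄ x y) → subst (λ z → Adj (x , y - + 1) (x , z)) (down-up y) (e₃ _ _)
    (e₅ x y) → subst (Adj (x + + 1 , y + + 1)) (cong₂ _,_ (up-down x) (up-down y)) (e₆ _ _)
    (e₆ x y) → subst (Adj (x - + 1 , y - + 1)) (cong₂ _,_ (down-up x) (down-up y)) (e₅ _ _)
  where
  up-down : ∀ z → z + + 1 - + 1 ≡ z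
  up-down z = solve (z ∷ [])
  down-up : ∀ z → z - + 1 + + 1 ≡ z
  down-up z = solve (z ∷ [])

shift-φ₀ : ∀ i v → φ i (shift i v) ≡ φ i v - + 1
shift-φ₀ 0F (x , y) = refl
shift-φ₀ 1F (x , y) = (x - (y + + 1) ≡ x - y - + 1) ∋ solve (x ∷ y ∷ [])
shift-φ₀ 2F (x , y) = (- (y + + 1) ≡ - y - + 1) ∋ solve (y ∷ [])
shift-φ₀ 3F (x , y) = (- (x + + 1) ≡ - x - + 1) ∋ solve (x ∷ [])
shift-φ₀ 4F (x , y) = (y - + 1 - x ≡ y - x - + 1) ∋ solve (x ∷ y ∷ [])
shift-φ₀ 5F (x , y) = refl

shift-φ₂ : ∀ i v → φ (next² i) (shift i v) ≡ φ (next² i) v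
shift-φ₂ 0F (x , y) = refl
shift-φ₂ 1F (x , y) = refl
shift-φ₂ 2F (x , y) = (y + + 1 - (x + + 1) ≡ y - x) ∋ solve (x ∷ y ∷ [])
shift-φ₂ 3F (x , y) = refl
shift-φ₂ 4F (x , y) = refl
shift-φ₂ 5F (x , y) = (x - + 1 - (y - + 1) ≡ x - y) ∋ solve (x ∷ y ∷ [])

-- `φ-next` and `φ-opposite` reduce this and the remaining directions to `shift-φ₀` and `shift-φ₂`,
-- the only two checked in coordinates.
shift-φ₁ : ∀ i v → φ (next i) (shift i v) ≡ φ (next i) v - + 1
shift-φ₁ i v = lemma (φ i v) (φ (next² i) v) (φ-next i (shift i v)) (shift-φ₀ i v) (shift-φ₂ i v) (φ-next i v)
  where
  lemma : ∀ a c {b a′ b′ c′} →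
    b′ ≡ a′ + c′ → a′ ≡ a - + 1 → c′ ≡ c → b ≡ a + c → b′ ≡ b - + 1
  lemma a c refl refl refl refl = solve (a ∷ c ∷ [])

φ-opposite-+1 : ∀ i v w → φ i w ≡ φ i v - + 1 → φ (next³ i) w ≡ φ (next³ i) v + + 1
φ-opposite-+1 i v w e = lemma (φ i v) (φ-opposite i w) (φ-opposite i v) e
  where
  lemma : ∀ a {b a′ b′} → b′ ≡ - b → a′ ≡ - a → b ≡ a - + 1 → b′ ≡ a′ + + 1
  lemma a refl refl refl = solve (a ∷ [])

shift-φ₃ : ∀ i v → φ (next³ i) (shift i v) ≡ φ (next³ i) v + + 1
shift-φ₃ i v = φ-opposite-+1 i v _ (shift-φ₀ i v)

shift-φ₄ : ∀ i v → φ (next⁴ i) (shift i v) ≡ φ (next⁴ i) v + + 1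
shift-φ₄ i v = φ-opposite-+1 (next i) v _ (shift-φ₁ i v)

shift-φ₅ : ∀ i v → φ (next⁵ i) (shift i v) ≡ φ (next⁵ i) v
shift-φ₅ i v = trans (φ-opposite (next² i) _)
  (trans (cong -_ (shift-φ₂ i v)) (sym (φ-opposite (next² i) v)))

-- Walks.

snoc : ∀ {u v w n} → Walk u v n → Adj v w → Walk u w (suc n)
snoc (here _) b = step b (here _)
snoc (step a p) b = step a (snoc p b)

walk-sym : ∀ {u v n} → Walk u v n → Walk v u n
walk-sym (here u) = here u
walk-sym (step a p) = snoc (walk-sym p) (adj-sym a)

_++ʷ_ : ∀ {u v w m n} → Walk u v m → Walk v w n → Walk u w (m ℕ.+ n)
here _ ++ʷ q = q
step a p ++ʷ q = step a (p ++ʷ q)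

-- An edge raises no functional by more than one; this is the lower bound on distances.
walk-φ : ∀ {u v n} → Walk u v n → ∀ i → φ i v ≤ᶻ φ i u + + n
walk-φ (here u) i = ≡⇒≤ (sym (ℤ.+-identityʳ _))
walk-φ (step {u} {v} {w} {n} a p) i = lemma (φ i u) (φ i v) (φ i w) (+ n) (walk-φ p i) (adj-φ a i)
  where
  adj-φ : ∀ {u v} → Adj u v → ∀ i → φ i v ≤ᶻ φ i u + + 1
  adj-φ {u} {v} a with i , refl ← adj⇒shift a = around i
      (down (φ i u) (shift-φ₀ i u)) (down (φ (next i) u) (shift-φ₁ i u))
      (flat (φ (next² i) u) (shift-φ₂ i u))
      (≡⇒≤ (shift-φ₃ i u)) (≡⇒≤ (shift-φ₄ i u)) 
      (flat (φ (next⁵ i) u) (shift-φ₅ i u))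
    where
    flat : ∀ a {b} → b ≡ a → b ≤ᶻ a + + 1
    flat a refl = linear (0≤+ 1) (solve (a ∷ []))
    down : ∀ a {b} → b ≡ a - + 1 → b ≤ᶻ a + + 1
    down a refl = linear (0≤+ 2) (solve (a ∷ []))
  lemma : ∀ a b c n → c ≤ᶻ b + n → b ≤ᶻ a + + 1 → c ≤ᶻ a + (+ 1 + n)
  lemma a b c n p q = linear (p ⊕ q) (solve (a ∷ b ∷ c ∷ n ∷ []))

-- The hexagon of two points and its enlargements.

H : Pt → Pt → Dir → ℤ
H v₁ v₂ i = φ i v₁ ⊔ φ i v₂

φ≤H₁ : ∀ v₁ v₂ i → φ i v₁ ≤ᶻ H v₁ v₂ i
φ≤H₁ v₁ v₂ i = ℤ.i≤i⊔j (φ i v₁) (φ i v₂)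

φ≤H₂ : ∀ v₁ v₂ i → φ i v₂ ≤ᶻ H v₁ v₂ i
φ≤H₂ v₁ v₂ i = ℤ.i≤j⊔i (φ i v₁) (φ i v₂)

-- `H` is the support function of the pair; for `c` zero the hexagon is the union of the geodesics
-- from `v₁` to `v₂`.
Within : ℕ → Pt → Pt → Pt → Set
Within c v₁ v₂ v = ∀ i → φ i v ≤ᶻ H v₁ v₂ i + + c

Within? : ∀ c v₁ v₂ v → Dec (Within c v₁ v₂ v)
Within? c v₁ v₂ v = all? λ i → φ i v ≤ᶻ? H v₁ v₂ i + + c

Within-mono : ∀ {b c v₁ v₂ v} → b ≤ c → Within b v₁ v₂ v → Within c v₁ v₂ v
Within-mono {v₁ = v₁} {v₂} b≤c p i = ℤ.≤-trans (p i) (ℤ.+-monoʳ-≤ (H v₁ v₂ i) (ℤ.+≤+ b≤c))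

-- Both points satisfy `φ-next`, and a maximum of sums is at most the sum of the maxima.
H-next : ∀ v₁ v₂ i → H v₁ v₂ (next i) ≤ᶻ H v₁ v₂ i + H v₁ v₂ (next² i)
H-next v₁ v₂ i = ℤ.⊔-lub (at v₁ (φ≤H₁ v₁ v₂)) (at v₂ (φ≤H₂ v₁ v₂))
  where
  at : ∀ v → (∀ j → φ j v ≤ᶻ H v₁ v₂ j) →
    φ (next i) v ≤ᶻ H v₁ v₂ i + H v₁ v₂ (next² i)
  at v p = ℤ.≤-trans (≡⇒≤ (φ-next i v)) (p i ⊕ p (next² i))

H-opposite : ∀ v₁ v₂ i → + 0 ≤ᶻ H v₁ v₂ i + H v₁ v₂ (next³ i)
H-opposite v₁ v₂ i = ℤ.≤-trans
  (≡⇒≤ (sym (trans (cong (λ z → φ i v₁ + z) (φ-opposite i v₁)) (ℤ.+-inverseʳ (φ i v₁)))))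
  (φ≤H₁ v₁ v₂ i ⊕ φ≤H₁ v₁ v₂ (next³ i))

H-opposite-⊓ : ∀ v₁ v₂ i → - (φ i v₁ ⊓ φ i v₂) ≡ H v₁ v₂ (next³ i)
H-opposite-⊓ v₁ v₂ i = trans (ℤ.neg-distrib-⊓-⊔ (φ i v₁) (φ i v₂))
  (sym (cong₂ _⊔_ (φ-opposite i v₁) (φ-opposite i v₂)))

-- The shift lowers the functionals `i` and `next i` by one, which pays for passing from `suc c` to
-- `c` there; only the other four directions need a hypothesis.
shift-within : ∀ {c v₁ v₂} i v (let h = H v₁ v₂) → Within (suc c) v₁ v₂ v →
  φ (next² i) v ≤ᶻ h (next² i) + + c → φ (next³ i) v + + 1 ≤ᶻ h (next³ i) + + c →
  φ (next⁴ i) v + + 1 ≤ᶻ h (next⁴ i) + + c → φ (next⁵ i) v ≤ᶻ h (next⁵ i) + + c →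
  Within c v₁ v₂ (shift i v)
shift-within {c} {v₁} {v₂} i v p p₂ p₃ p₄ p₅ = around i
    (into (shift-φ₀ i v) (pred i)) (into (shift-φ₁ i v) (pred (next i)))
    (into (shift-φ₂ i v) p₂) (into (shift-φ₃ i v) p₃)
    (into (shift-φ₄ i v) p₄) (into (shift-φ₅ i v) p₅)
  where
  into : ∀ {a b c} → a ≡ b → b ≤ᶻ c → a ≤ᶻ c
  into e = ℤ.≤-trans (≡⇒≤ e)
  lemma : ∀ a h n → a ≤ᶻ h + (+ 1 + n) → a - + 1 ≤ᶻ h + n
  lemma a h n p = linear p (solve (a ∷ h ∷ n ∷ []))
  pred : ∀ j → φ j v - + 1 ≤ᶻ H v₁ v₂ j + + c
  pred j = lemma (φ j v) (H v₁ v₂ j) (+ c) (p j)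

-- fᵢ and hᵢ are φ and its bound H in the direction nextⁱ j.
module Violated (f₀ f₁ f₂ f₃ f₄ f₅ h₀ h₁ h₂ h₃ h₄ h₅ n : ℤ) (0≤n : + 0 ≤ᶻ n)
  (f₁≡ : f₁ ≡ f₀ + f₂) (f₃≡ : f₃ ≡ - f₀) (f₄≡ : f₄ ≡ - f₁) (f₅≡ : f₅ ≡ - f₂)
  (h₀≤h₅+h₁ : h₀ ≤ᶻ h₅ + h₁) (h₁≤h₀+h₂ : h₁ ≤ᶻ h₀ + h₂)
  (h₂≤h₁+h₃ : h₂ ≤ᶻ h₁ + h₃) (h₄≤h₃+h₅ : h₄ ≤ᶻ h₃ + h₅)
  (0≤h₀+h₃ : + 0 ≤ᶻ h₀ + h₃) (0≤h₁+h₄ : + 0 ≤ᶻ h₁ + h₄) (0≤h₂+h₅ : + 0 ≤ᶻ h₂ + h₅)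
  (f₀≤ : f₀ ≤ᶻ h₀ + (+ 1 + n)) (f₁≤ : f₁ ≤ᶻ h₁ + (+ 1 + n)) (f₂≤ : f₂ ≤ᶻ h₂ + (+ 1 + n))
  (f₁-violated : + 1 + (h₁ + n) ≤ᶻ f₁)
  where

  -- Here `f₃ = f₂ - f₁`, where `f₂` overshoots `h₂ + n` by at most one and `f₁` overshoots `h₁ + n`
  -- by at least one; so `f₃` is at most `h₂ - h₁`, hence at most `h₃`.
  f₃≤h₃ : f₃ ≤ᶻ h₃ + n
  f₃≤h₃ = linear (f₁-violated ⊕ f₂≤ ⊕ ≡⇒≤ f₁≡ ⊕ ≡⇒≤ f₃≡ ⊕ h₂≤h₁+h₃ ⊕ 0≤n)
    (solve (f₀ ∷ f₁ ∷ f₂ ∷ f₃ ∷ h₁ ∷ h₂ ∷ h₃ ∷ n ∷ []))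

  f₄<h₄ : f₄ + + 1 ≤ᶻ h₄ + n
  f₄<h₄ = linear (f₁-violated ⊕ ≡⇒≤ f₄≡ ⊕ 0≤h₁+h₄ ⊕ 0≤n ⊕ 0≤n)
    (solve (f₁ ∷ f₄ ∷ h₁ ∷ h₄ ∷ n ∷ []))

  f₅≤h₅ : f₅ ≤ᶻ h₅ + n
  f₅≤h₅ = linear (f₁-violated ⊕ f₀≤ ⊕ ≡⇒≤ f₁≡ ⊕ ≡⇒≤ f₅≡ ⊕ h₀≤h₅+h₁ ⊕ 0≤n)
    (solve (f₀ ∷ f₁ ∷ f₂ ∷ f₅ ∷ h₀ ∷ h₁ ∷ h₅ ∷ n ∷ []))

  -- Both violations would make `f₁ = f₀ + f₂` overshoot `h₁ + n` by at least two, against `f₁≤`.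
  ¬0∧2 : + 1 + (h₀ + n) ≤ᶻ f₀ → + 1 + (h₂ + n) ≤ᶻ f₂ → + 1 ≤ᶻ + 0
  ¬0∧2 p q = linear (p ⊕ q ⊕ f₁≤ ⊕ ≡⇒≤ (sym f₁≡) ⊕ h₁≤h₀+h₂ ⊕ 0≤n)
    (solve (f₀ ∷ f₁ ∷ f₂ ∷ h₀ ∷ h₁ ∷ h₂ ∷ n ∷ []))

  ¬0∧3 : + 1 + (h₀ + n) ≤ᶻ f₀ → + 1 + (h₃ + n) ≤ᶻ f₃ + + 1 → + 1 ≤ᶻ + 0
  ¬0∧3 p q = linear (p ⊕ q ⊕ ≡⇒≤ f₃≡ ⊕ 0≤h₀+h₃ ⊕ 0≤n ⊕ 0≤n)
    (solve (f₀ ∷ f₃ ∷ h₀ ∷ h₃ ∷ n ∷ []))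

  ¬2∧5 : + 1 + (h₂ + n) ≤ᶻ f₂ → + 1 + (h₅ + n) ≤ᶻ f₅ + + 1 → + 1 ≤ᶻ + 0
  ¬2∧5 p q = linear (p ⊕ q ⊕ ≡⇒≤ f₅≡ ⊕ 0≤h₂+h₅ ⊕ 0≤n ⊕ 0≤n)
    (solve (f₂ ∷ f₅ ∷ h₂ ∷ h₅ ∷ n ∷ []))

  -- The sum `f₃ + f₅ = - f₁` lies below `- h₁`, hence below `h₄` and below `h₃ + h₅`.
  ¬3∧5 : + 1 + (h₃ + n) ≤ᶻ f₃ + + 1 → + 1 + (h₅ + n) ≤ᶻ f₅ + + 1 → + 1 ≤ᶻ + 0
  ¬3∧5 p q = linear
    (p ⊕ q ⊕ f₁-violated ⊕ ≡⇒≤ f₃≡ ⊕ ≡⇒≤ f₅≡ ⊕ ≡⇒≤ f₁≡ ⊕ h₄≤h₃+h₅ ⊕ 0≤h₁+h₄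
      ⊕ 0≤n ⊕ 0≤n ⊕ 0≤n)
    (solve (f₀ ∷ f₁ ∷ f₂ ∷ f₃ ∷ f₅ ∷ h₁ ∷ h₃ ∷ h₄ ∷ h₅ ∷ n ∷ []))

-- Two half-planes violated at once are consecutive, so that a single step,
-- namely shift j or shift (next j) when next j is violated, repairs both.
repair : ∀ c v₁ v₂ v j → Within (suc c) v₁ v₂ v →
  + 1 + (H v₁ v₂ (next j) + + c) ≤ᶻ φ (next j) v →
  ∃[ w ] (Adj w v × Within c v₁ v₂ w)
repair c v₁ v₂ v j p bad =
    go (φ (next² j) v ≤ᶻ? h (next² j) + n) (φ (next³ j) v + + 1 ≤ᶻ? h (next³ j) + n)
       (φ j v ≤ᶻ? h j + n) (φ (next⁵ j) v + + 1 ≤ᶻ? h (next⁵ j) + n)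
  where
  h = H v₁ v₂
  n = + c

  open Violated
    (φ j v) (φ (next j) v) (φ (next² j) v) (φ (next³ j) v) (φ (next⁴ j) v) (φ (next⁵ j) v)
    (h j) (h (next j)) (h (next² j)) (h (next³ j)) (h (next⁴ j)) (h (next⁵ j)) n (0≤+ c)
    (φ-next j v) (φ-opposite j v) (φ-opposite (next j) v) (φ-opposite (next² j) v)
    (subst (λ i → h i ≤ᶻ h (next⁵ j) + h (next i)) (next⁶≡id j) (H-next v₁ v₂ (next⁵ j)))
    (H-next v₁ v₂ j) (H-next v₁ v₂ (next j)) (H-next v₁ v₂ (next³ j))
    (H-opposite v₁ v₂ j) (H-opposite v₁ v₂ (next j)) (H-opposite v₁ v₂ (next² j))
    (p j) (p (next j)) (p (next² j)) bad

  absurd : ∀ {A : Set} → + 1 ≤ᶻ + 0 → A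
  absurd (ℤ.+≤+ ())

  ok₀ : φ j v ≤ᶻ h j + n → φ (next⁵ (next j)) v ≤ᶻ h (next⁵ (next j)) + n
  ok₀ = subst (λ i → φ i v ≤ᶻ h i + n) (sym (next⁶≡id j))

  by : ∀ i → Within c v₁ v₂ (shift i v) → ∃[ w ] (Adj w v × Within c v₁ v₂ w)
  by i q = shift i v , adj-sym (shift-adj i v) , q

  go : Dec (φ (next² j) v ≤ᶻ h (next² j) + n) → Dec (φ (next³ j) v + + 1 ≤ᶻ h (next³ j) + n) →
       Dec (φ j v ≤ᶻ h j + n) → Dec (φ (next⁵ j) v + + 1 ≤ᶻ h (next⁵ j) + n) →
       ∃[ w ] (Adj w v × Within c v₁ v₂ w)
  -- `shift j` can fail only in directions `next² j` and `next³ j`, `shift (next j)` only in `j` and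
  -- `next⁵ j`. If both shifts fail, one failure of each contradict each other.
  go (yes q₂) (yes q₃) _ _ = by j (shift-within j v p q₂ q₃ f₄<h₄ f₅≤h₅)
  go _ _ (yes q₀) (yes q₅) = by (next j) (shift-within (next j) v p f₃≤h₃ f₄<h₄ q₅ (ok₀ q₀))
  go (no q₂) _ (no q₀) _ = absurd (¬0∧2 (≰⇒1+≤ q₀) (≰⇒1+≤ q₂))
  go (no q₂) _ _ (no q₅) = absurd (¬2∧5 (≰⇒1+≤ q₂) (≰⇒1+≤ q₅))
  go _ (no q₃) (no q₀) _ = absurd (¬0∧3 (≰⇒1+≤ q₀) (≰⇒1+≤ q₃))
  go _ (no q₃) _ (no q₅) = absurd (¬3∧5 (≰⇒1+≤ q₃) (≰⇒1+≤ q₅))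

retract : ∀ c v₁ v₂ v → Within (suc c) v₁ v₂ v →
  Within c v₁ v₂ v ⊎ ∃[ w ] (Adj w v × Within c v₁ v₂ w)
retract c v₁ v₂ v p with Within? c v₁ v₂ v
... | yes q = inj₁ q
... | no ¬q with i , ¬qᵢ ← ¬∀⟶∃¬ 6 _ (λ i → φ i v ≤ᶻ? H v₁ v₂ i + + c) ¬q =
  -- `repair` takes the predecessor of the violated direction, and `next⁵` inverts `next`.
  inj₂ (repair c v₁ v₂ v (next⁵ i) p
    (subst (λ j → + 1 + (H v₁ v₂ j + + c) ≤ᶻ φ j v) (sym (next⁶≡id i)) (≰⇒1+≤ ¬qᵢ)))

descend : ∀ c v₁ v₂ v → Within c v₁ v₂ v → ∃[ w ] ∃[ l ] (l ≤ c × Walk w v l × Within 0 v₁ v₂ w)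
descend zero v₁ v₂ v p = v , 0 , z≤n , here v , p
descend (suc c) v₁ v₂ v p with retract c v₁ v₂ v p
... | inj₁ q with w , l , l≤c , r , q₀ ← descend c v₁ v₂ v q =
  w , l , ℕ.m≤n⇒m≤1+n l≤c , r , q₀
... | inj₂ (x , a , q) with w , l , l≤c , r , q₀ ← descend c v₁ v₂ x q =
  w , suc l , s≤s l≤c , snoc r a , q₀

-- Distances and sectors.

φ-separates : ∀ u v → (∀ i → φ i u ≤ᶻ φ i v + + 0) → u ≡ v
φ-separates u v p = cong₂ _,_ (equal 0F (φ-opposite-≤ 3F u v (+ 0) (p 3F)))
                              (equal 5F (φ-opposite-≤ 2F u v (+ 0) (p 2F)))
  where
  equal : ∀ i → φ i v ≤ᶻ φ i u + + 0 → φ i u ≡ φ i v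
  equal i q = ℤ.≤-antisym (subst (φ i u ≤ᶻ_) (ℤ.+-identityʳ (φ i v)) (p i))
                            (subst (φ i v ≤ᶻ_) (ℤ.+-identityʳ (φ i u)) q)

-- The hypothesis places `v` in the hexagon of the pair `u`, `u` enlarged by `n`. The unenlarged
-- hexagon is `u` alone, so `descend` ends there.
φ-walk : ∀ n u v → (∀ i → φ i v ≤ᶻ φ i u + + n) → ∃[ l ] (l ≤ n × Walk u v l)
φ-walk n u v p with w , l , l≤n , q , w-within ← descend n u u v
    (λ i → ℤ.≤-trans (p i) (ℤ.+-monoˡ-≤ (+ n) (φ≤H₁ u u i)))
  with refl ← φ-separates w u (λ i → ℤ.≤-trans (w-within i)
    (ℤ.+-monoˡ-≤ (+ 0) (≡⇒≤ (ℤ.⊔-idem (φ i u)))))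
  = l , l≤n , q

φ-flip : ∀ i u v → φ i u ≤ᶻ φ i v → φ (next³ i) v ≤ᶻ φ (next³ i) u
φ-flip i u v p = subst₂ _≤ᶻ_ (sym (φ-opposite i v)) (sym (φ-opposite i u)) (ℤ.neg-mono-≤ p)

φ-unflip : ∀ i {u v} → φ (next³ i) v ≤ᶻ φ (next³ i) u → φ i u ≤ᶻ φ i v
φ-unflip i {u} {v} p = ℤ.neg-cancel-≤ (subst₂ _≤ᶻ_ (φ-opposite i v) (φ-opposite i u) p)

-- The point v lies in the 60° sector at u on which the distance from u is φ (next s).
Sector : Dir → Pt → Pt → Set
Sector s u v = φ s u ≤ᶻ φ s v × φ (next² s) u ≤ᶻ φ (next² s) v

-- If `x` and `y` change in opposite senses, the sector is settled; otherwise the change of `x - y`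
-- decides between two.
sector : ∀ u v → ∃[ s ] Sector s u v
sector u v with ℤ.≤-total (φ 0F u) (φ 0F v) | ℤ.≤-total (φ 5F u) (φ 5F v)
              | ℤ.≤-total (φ 1F u) (φ 1F v)
... | inj₁ x | inj₂ y | _      = 0F , x , φ-flip 5F v u y
... | inj₂ x | inj₁ y | _      = 3F , φ-flip 0F v u x , y
... | inj₁ x | inj₁ y | inj₁ z = 5F , y , z
... | inj₁ x | inj₁ y | inj₂ z = 4F , φ-flip 1F v u z , x
... | inj₂ x | inj₂ y | inj₁ z = 1F , z , φ-flip 0F v u x
... | inj₂ x | inj₂ y | inj₂ z = 2F , φ-flip 5F v u y , φ-flip 1F v u z

sector-gap : ∀ s u v → Sector s u v → ∃[ n ] φ (next s) v ≡ φ (next s) u + + n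
sector-gap s u v (p , q) =
  ≤⇒∃ (subst₂ _≤ᶻ_ (sym (φ-next s u)) (sym (φ-next s v)) (p ⊕ q))

-- The rises of `φ s` and `φ (next² s)` are nonnegative with sum `n`, so neither exceeds `n`; the
-- three opposite functionals do not rise.
sector-walk : ∀ s u v n → Sector s u v → φ (next s) v ≡ φ (next s) u + + n →
  ∃[ l ] (l ≤ n × Walk u v l)
sector-walk s u v n (p , q) e = φ-walk n u v (around s
    (lemma₀ (φ s u) (φ s v) (φ (next² s) u) (φ (next² s) v) (+ n) total q)
    (≡⇒≤ e)
    (lemma₂ (φ s u) (φ s v) (φ (next² s) u) (φ (next² s) v) (+ n) total p)
    (φ-opposite-≤ s u v (+ n) (weaken s p))
    (φ-opposite-≤ (next s) u v (+ n) 
      (weaken (next s) (subst (φ (next s) u ≤ᶻ_) (sym e) (ℤ.i≤i+j (φ (next s) u) (+ n)))))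
    (φ-opposite-≤ (next² s) u v (+ n) (weaken (next² s) q)))
  where
  weaken : ∀ i → φ i u ≤ᶻ φ i v → φ i u ≤ᶻ φ i v + + n
  weaken i p = ℤ.≤-trans p (ℤ.i≤i+j (φ i v) (+ n))
  total : φ s v + φ (next² s) v ≤ᶻ φ s u + φ (next² s) u + + n
  total = ≡⇒≤ (trans (sym (φ-next s v)) (trans e (cong (λ z → z + + n) (φ-next s u))))
  lemma₀ : ∀ a a′ b b′ n → a′ + b′ ≤ᶻ a + b + n → b ≤ᶻ b′ → a′ ≤ᶻ a + n
  lemma₀ a a′ b b′ n t p = linear (t ⊕ p) (solve (a ∷ a′ ∷ b ∷ b′ ∷ n ∷ []))
  lemma₂ : ∀ a a′ b b′ n → a′ + b′ ≤ᶻ a + b + n → a ≤ᶻ a′ → b′ ≤ᶻ b + n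
  lemma₂ a a′ b b′ n t p = linear (t ⊕ p) (solve (a ∷ a′ ∷ b ∷ b′ ∷ n ∷ []))

-- `walk-φ` bounds the rise of `φ (next s)` by `k`, and `sector-walk` gives a walk no longer than
-- this rise.
distance : ∀ {u v k} → IsDist u v k → ∃[ s ] (Sector s u v × φ (next s) v ≡ φ (next s) u + + k)
distance {u} {v} {k} (w , min) = go (sector u v)
  where
  k≡ : ∀ s n → Sector s u v → φ (next s) v ≡ φ (next s) u + + n → n ≡ k
  k≡ s n m e = ℕ.≤-antisym
    (+-cancelˡ-≤ (φ (next s) u) (subst (_≤ᶻ φ (next s) u + + k) e (walk-φ w (next s))))
    (let l , l≤n , r = sector-walk s u v n m e in ℕ.≤-trans (min l r) l≤n)
  go : (∃[ s ] Sector s u v) → ∃[ s ] (Sector s u v × φ (next s) v ≡ φ (next s) u + + k)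
  go (s , m) = s , m , at (sector-gap s u v m)
    where
    at : (∃[ n ] φ (next s) v ≡ φ (next s) u + + n) → φ (next s) v ≡ φ (next s) u + + k
    at (n , e) = trans e (cong (λ z → φ (next s) u + + z) (k≡ s n m e))

-- In directions `s` and `next² s` the maximum `H` is attained at `v₂`, in their opposites at `v₁`,
-- so `w` lies between the two points in both.
sector-split : ∀ {v₁ v₂} w s → Sector s v₁ v₂ → Within 0 v₁ v₂ w → Sector s v₁ w × Sector s w v₂
sector-split {v₁} {v₂} w s (m₀ , m₂) p =
    (above s m₀ , above (next² s) m₂) , (below s m₀ , below (next² s) m₂)
  where
  bound : ∀ i {h} → H v₁ v₂ i ≡ h → φ i w ≤ᶻ h
  bound i q = ℤ.≤-trans (p i) (≡⇒≤ (trans (ℤ.+-identityʳ (H v₁ v₂ i)) q))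
  below : ∀ i → φ i v₁ ≤ᶻ φ i v₂ → φ i w ≤ᶻ φ i v₂
  below i m = bound i (ℤ.i≤j⇒i⊔j≡j m)
  above : ∀ i → φ i v₁ ≤ᶻ φ i v₂ → φ i v₁ ≤ᶻ φ i w
  above i m = φ-unflip i (bound (next³ i) (ℤ.i≥j⇒i⊔j≡i (φ-flip i v₁ v₂ m)))

-- Both pieces stay in sector `s`, and their rises of `φ (next s)` add up to `k`.
geodesic : ∀ {v₁ v₂ k} w → IsDist v₁ v₂ k → Within 0 v₁ v₂ w →
  ∃[ l₁ ] ∃[ l₂ ] (l₁ ℕ.+ l₂ ≤ k × Walk v₁ w l₁ × Walk w v₂ l₂)
geodesic {v₁} {v₂} {k} w d p = go (distance d)
  where
  go : ∃[ s ] (Sector s v₁ v₂ × φ (next s) v₂ ≡ φ (next s) v₁ + + k) →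
    ∃[ l₁ ] ∃[ l₂ ] (l₁ ℕ.+ l₂ ≤ k × Walk v₁ w l₁ × Walk w v₂ l₂)
  go (s , m , e) = join (sector-gap s v₁ w (proj₁ m′)) (sector-gap s w v₂ (proj₂ m′))
    where
    m′ = sector-split w s m p
    join : (∃[ n ] φ (next s) w ≡ φ (next s) v₁ + + n) →
      (∃[ n ] φ (next s) v₂ ≡ φ (next s) w + + n) →
      ∃[ l₁ ] ∃[ l₂ ] (l₁ ℕ.+ l₂ ≤ k × Walk v₁ w l₁ × Walk w v₂ l₂)
    join (n₁ , eq₁) (n₂ , eq₂) =
      let l₁ , l₁≤ , r₁ = sector-walk s v₁ w n₁ (proj₁ m′) eq₁
          l₂ , l₂≤ , r₂ = sector-walk s w v₂ n₂ (proj₂ m′) eq₂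
      in l₁ , l₂ , ℕ.≤-trans (ℕ.+-mono-≤ l₁≤ l₂≤) n₁+n₂≤k , r₁ , r₂
      where
      n₁+n₂≤k : n₁ ℕ.+ n₂ ≤ k
      n₁+n₂≤k = +-cancelˡ-≤ (φ (next s) v₁) (≡⇒≤ (trans
        (sym (ℤ.+-assoc (φ (next s) v₁) (+ n₁) (+ n₂)))
        (trans (cong (λ z → z + + n₂) (sym eq₁)) (trans (sym eq₂) e))))

-- Trees and stars.

open DecMembership (≡-dec ℤ._≟_ ℤ._≟_) using (_∈?_)

-- `grow` accepts only new vertices, so a step to a vertex already present is skipped and the edge
-- count is merely bounded.
extend : ∀ {vs n u w l} → Tree vs n → u ∈ vs → Walk u w l →
  ∃[ vs′ ] ∃[ n′ ] (Tree vs′ n′ × n′ ≤ n ℕ.+ l × vs ⊆ vs′ × w ∈ vs′)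
extend {vs} {n} t u∈ (here _) =
  vs , n , t , ℕ.≤-reflexive (sym (ℕ.+-identityʳ n)) , (λ x∈ → x∈) , u∈
extend {vs} {n} t u∈ (step {v = x} {n = l} a p) with x ∈? vs
... | yes x∈ with vs′ , n′ , t′ , n′≤ , sub , w∈ ← extend t x∈ p =
  vs′ , n′ , t′ , ℕ.≤-trans n′≤ (ℕ.+-monoʳ-≤ n (ℕ.n≤1+n l)) , sub , w∈
... | no x∉ with vs′ , n′ , t′ , n′≤ , sub , w∈ ← extend (grow t u∈ a x∉) (here refl) p =
  vs′ , n′ , t′ , ℕ.≤-trans n′≤ (ℕ.≤-reflexive (sym (ℕ.+-suc n l))) , sub ∘ there , w∈

star⇒tree : ∀ {w v₁ v₂ v₃ l₁ l₂ l₃} → Walk w v₁ l₁ → Walk w v₂ l₂ → Walk w v₃ l₃ →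
  ∃[ m ] (m ≤ l₁ ℕ.+ l₂ ℕ.+ l₃ × TreeThrough v₁ v₂ v₃ m)
star⇒tree {w} {l₂ = l₂} {l₃} p₁ p₂ p₃
  with vs₁ , n₁ , t₁ , n₁≤ , sub₁ , v₁∈ ← extend (single w) (here refl) p₁
  with vs₂ , n₂ , t₂ , n₂≤ , sub₂ , v₂∈ ← extend t₁ (sub₁ (here refl)) p₂
  with vs₃ , n₃ , t₃ , n₃≤ , sub₃ , v₃∈ ← extend t₂ (sub₂ (sub₁ (here refl))) p₃
  = n₃
  , ℕ.≤-trans n₃≤ (ℕ.+-monoˡ-≤ l₃ (ℕ.≤-trans n₂≤ (ℕ.+-monoˡ-≤ l₂ n₁≤)))
  , vs₃ , t₃ , sub₃ (sub₂ v₁∈) , sub₃ v₂∈ , v₃∈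

tree-walk : ∀ {vs n u v} → Tree vs n → u ∈ vs → v ∈ vs → ∃[ l ] (l ≤ n × Walk u v l)
tree-walk (single v) (here refl) (here refl) = 0 , z≤n , here v
tree-walk (grow t x∈ a _) (here refl) (here refl) = 0 , z≤n , here _
tree-walk (grow t x∈ a _) (here refl) (there q) with l , l≤ , r ← tree-walk t x∈ q =
  suc l , s≤s l≤ , step (adj-sym a) r
tree-walk (grow t x∈ a _) (there p) (here refl) with l , l≤ , r ← tree-walk t p x∈ =
  suc l , s≤s l≤ , snoc r a
tree-walk (grow t x∈ a _) (there p) (there q) with l , l≤ , r ← tree-walk t p q =
  l , ℕ.m≤n⇒m≤1+n l≤ , r

Star : Pt → Pt → Pt → ℕ → Set
Star v₁ v₂ v₃ n = ∃[ w ] ∃[ l₁ ] ∃[ l₂ ] ∃[ l₃ ]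
  (Walk w v₁ l₁ × Walk w v₂ l₂ × Walk w v₃ l₃ × l₁ ℕ.+ l₂ ℕ.+ l₃ ≤ n)

-- Induction on the attached leaves. A leaf equal to one of the three points is replaced by its
-- neighbour in the smaller tree, and that leg grows by one edge; a leaf equal to at least two of
-- them is itself the centre.
tree⇒star : ∀ {vs n v₁ v₂ v₃} → Tree vs n → v₁ ∈ vs → v₂ ∈ vs → v₃ ∈ vs → Star v₁ v₂ v₃ n
tree⇒star (single _) (here refl) (here refl) (here refl) =
  _ , 0 , 0 , 0 , here _ , here _ , here _ , z≤n
tree⇒star t@(grow _ _ _ _) (here refl) (here refl) r
  with l , l≤ , s ← tree-walk t (here refl) r =
  _ , 0 , 0 , l , here _ , here _ , s , l≤
tree⇒star t@(grow _ _ _ _) (here refl) q@(there _) (here refl)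
  with l , l≤ , s ← tree-walk t (here refl) q =
  _ , 0 , l , 0 , here _ , s , here _ , ℕ.≤-trans (ℕ.≤-reflexive (ℕ.+-identityʳ l)) l≤
tree⇒star t@(grow _ _ _ _) p@(there _) (here refl) (here refl)
  with l , l≤ , s ← tree-walk t (here refl) p =
  _ , l , 0 , 0 , s , here _ , here _ ,
  ℕ.≤-trans (ℕ.≤-reflexive (trans (ℕ.+-identityʳ (l ℕ.+ 0)) (ℕ.+-identityʳ l))) l≤
tree⇒star (grow t x∈ a _) (here refl) (there q) (there r)
  with w , l₁ , l₂ , l₃ , p₁ , p₂ , p₃ , l≤ ← tree⇒star t x∈ q r =
  w , suc l₁ , l₂ , l₃ , snoc p₁ a , p₂ , p₃ , s≤s l≤
tree⇒star (grow t x∈ a _) (there p) (here refl) (there r)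
  with w , l₁ , l₂ , l₃ , p₁ , p₂ , p₃ , l≤ ← tree⇒star t p x∈ r =
  w , l₁ , suc l₂ , l₃ , p₁ , snoc p₂ a , p₃ ,
  ℕ.≤-trans (ℕ.≤-reflexive (cong (ℕ._+ l₃) (ℕ.+-suc l₁ l₂))) (s≤s l≤)
tree⇒star (grow t x∈ a _) (there p) (there q) (here refl)
  with w , l₁ , l₂ , l₃ , p₁ , p₂ , p₃ , l≤ ← tree⇒star t p q x∈ =
  w , l₁ , l₂ , suc l₃ , p₁ , p₂ , snoc p₃ a ,
  ℕ.≤-trans (ℕ.≤-reflexive (ℕ.+-suc (l₁ ℕ.+ l₂) l₃)) (s≤s l≤)
tree⇒star (grow t x∈ a _) (there p) (there q) (there r)
  with w , l₁ , l₂ , l₃ , p₁ , p₂ , p₃ , l≤ ← tree⇒star t p q r =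
  w , l₁ , l₂ , l₃ , p₁ , p₂ , p₃ , ℕ.m≤n⇒m≤1+n l≤

spanning-tree : ∀ {v₁ v₂ k c v} → IsDist v₁ v₂ k → Within c v₁ v₂ v →
  ∃[ m ] (m ≤ k ℕ.+ c × TreeThrough v₁ v₂ v m)
spanning-tree {v₁} {v₂} {k} {c} {v} d p =
  let w , l , l≤c , r , q = descend c v₁ v₂ v p
      l₁ , l₂ , l₁+l₂≤k , r₁ , r₂ = geodesic w d q
      m , m≤ , t = star⇒tree (walk-sym r₁) r₂ r
  in m , ℕ.≤-trans m≤ (ℕ.+-mono-≤ l₁+l₂≤k l≤c) , t

-- Lower bound on the size of a tree.

-- aᵢ, bᵢ and wᵢ are φ at v₁, v₂ and the centre of a star, in the direction nextⁱ s
-- of a sector s containing v₂ − v₁.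
module Excess
  (a₀ a₁ a₂ a₃ a₄ a₅ b₀ b₁ b₂ w₀ w₁ w₂ w₃ w₄ w₅ k l₁ l₂ : ℤ)
  (0≤l₁ : + 0 ≤ᶻ l₁) (0≤l₂ : + 0 ≤ᶻ l₂)
  (a₁≡ : a₁ ≡ a₀ + a₂) (a₃≡ : a₃ ≡ - a₀) (a₄≡ : a₄ ≡ - a₁) (a₅≡ : a₅ ≡ - a₂)
  (b₁≡ : b₁ ≡ b₀ + b₂)
  (w₁≡ : w₁ ≡ w₀ + w₂) (w₃≡ : w₃ ≡ - w₀) (w₄≡ : w₄ ≡ - w₁) (w₅≡ : w₅ ≡ - w₂)
  (b₁≡a₁+k : b₁ ≡ a₁ + k)
  (w₀≤ : w₀ ≤ᶻ a₀ + l₁) (w₁≤ : w₁ ≤ᶻ a₁ + l₁) (w₂≤ : w₂ ≤ᶻ a₂ + l₁)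
  (b₀≤ : b₀ ≤ᶻ w₀ + l₂) (b₁≤ : b₁ ≤ᶻ w₁ + l₂) (b₂≤ : b₂ ≤ᶻ w₂ + l₂)
  where

  -- Here `k + w₀ = b₁ - a₁ + w₁ - w₂`; the leg to `v₁` bounds `w₁ - a₁` by `l₁`, the leg to `v₂`
  -- bounds `b₂ - w₂` by `l₂`, and `b₁ - b₂ = b₀`.
  excess₀ : k + w₀ ≤ᶻ b₀ + (l₁ + l₂)
  excess₀ = linear (b₂≤ ⊕ w₁≤ ⊕ ≡⇒≤ (sym b₁≡a₁+k) ⊕ ≡⇒≤ b₁≡ ⊕ ≡⇒≤ (sym w₁≡))
    (solve (a₁ ∷ b₀ ∷ b₁ ∷ b₂ ∷ w₀ ∷ w₁ ∷ w₂ ∷ k ∷ l₁ ∷ l₂ ∷ []))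

  excess₁ : k + w₁ ≤ᶻ b₁ + (l₁ + l₂)
  excess₁ = linear (w₁≤ ⊕ ≡⇒≤ (sym b₁≡a₁+k) ⊕ 0≤l₂)
    (solve (a₁ ∷ b₁ ∷ w₁ ∷ k ∷ l₁ ∷ l₂ ∷ []))

  excess₂ : k + w₂ ≤ᶻ b₂ + (l₁ + l₂)
  excess₂ = linear (b₀≤ ⊕ w₁≤ ⊕ ≡⇒≤ (sym b₁≡a₁+k) ⊕ ≡⇒≤ b₁≡ ⊕ ≡⇒≤ (sym w₁≡))
    (solve (a₁ ∷ b₀ ∷ b₁ ∷ b₂ ∷ w₀ ∷ w₁ ∷ w₂ ∷ k ∷ l₁ ∷ l₂ ∷ []))

  excess₃ : k + w₃ ≤ᶻ a₃ + (l₁ + l₂)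
  excess₃ = linear
    (≡⇒≤ w₃≡ ⊕ ≡⇒≤ (sym a₃≡) ⊕ b₁≤ ⊕ w₂≤ ⊕ ≡⇒≤ (sym b₁≡a₁+k) ⊕ ≡⇒≤ w₁≡ ⊕ ≡⇒≤ (sym a₁≡))
    (solve (a₀ ∷ a₁ ∷ a₂ ∷ a₃ ∷ b₁ ∷ w₀ ∷ w₁ ∷ w₂ ∷ w₃ ∷ k ∷ l₁ ∷ l₂ ∷ []))

  excess₄ : k + w₄ ≤ᶻ a₄ + (l₁ + l₂)
  excess₄ = linear (≡⇒≤ w₄≡ ⊕ ≡⇒≤ (sym a₄≡) ⊕ b₁≤ ⊕ ≡⇒≤ (sym b₁≡a₁+k) ⊕ 0≤l₁)
    (solve (a₁ ∷ a₄ ∷ b₁ ∷ w₁ ∷ w₄ ∷ k ∷ l₁ ∷ l₂ ∷ []))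

  excess₅ : k + w₅ ≤ᶻ a₅ + (l₁ + l₂)
  excess₅ = linear
    (≡⇒≤ w₅≡ ⊕ ≡⇒≤ (sym a₅≡) ⊕ b₁≤ ⊕ w₀≤ ⊕ ≡⇒≤ (sym b₁≡a₁+k) ⊕ ≡⇒≤ w₁≡ ⊕ ≡⇒≤ (sym a₁≡))
    (solve (a₀ ∷ a₁ ∷ a₂ ∷ a₅ ∷ b₁ ∷ w₀ ∷ w₁ ∷ w₂ ∷ w₅ ∷ k ∷ l₁ ∷ l₂ ∷ []))

excess : ∀ {v₁ v₂ w k l₁ l₂} → IsDist v₁ v₂ k → Walk w v₁ l₁ → Walk w v₂ l₂ →
  ∀ i → + k + φ i w ≤ᶻ H v₁ v₂ i + + (l₁ ℕ.+ l₂)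
excess {v₁} {v₂} {w} {k} {l₁} {l₂} d p₁ p₂ = go (distance d)
  where
  by₁ : ∀ i → + k + φ i w ≤ᶻ φ i v₁ + + (l₁ ℕ.+ l₂) → + k + φ i w ≤ᶻ H v₁ v₂ i + + (l₁ ℕ.+ l₂)
  by₁ i q = ℤ.≤-trans q (ℤ.+-monoˡ-≤ (+ (l₁ ℕ.+ l₂)) (φ≤H₁ v₁ v₂ i))
  by₂ : ∀ i → + k + φ i w ≤ᶻ φ i v₂ + + (l₁ ℕ.+ l₂) → + k + φ i w ≤ᶻ H v₁ v₂ i + + (l₁ ℕ.+ l₂)
  by₂ i q = ℤ.≤-trans q (ℤ.+-monoˡ-≤ (+ (l₁ ℕ.+ l₂)) (φ≤H₂ v₁ v₂ i))
  into : ∀ i → φ i w ≤ᶻ φ i v₁ + + l₁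
  into = walk-φ (walk-sym p₁)
  go : ∃[ s ] (Sector s v₁ v₂ × φ (next s) v₂ ≡ φ (next s) v₁ + + k) →
    ∀ i → + k + φ i w ≤ᶻ H v₁ v₂ i + + (l₁ ℕ.+ l₂)
  go (s , _ , e) = around s (by₂ s excess₀) (by₂ (next s) excess₁) (by₂ (next² s) excess₂)
      (by₁ (next³ s) excess₃) (by₁ (next⁴ s) excess₄) (by₁ (next⁵ s) excess₅)
    where
    open Excess
      (φ s v₁) (φ (next s) v₁) (φ (next² s) v₁) (φ (next³ s) v₁) (φ (next⁴ s) v₁) (φ (next⁵ s) v₁)
      (φ s v₂) (φ (next s) v₂) (φ (next² s) v₂)
      (φ s w) (φ (next s) w) (φ (next² s) w) (φ (next³ s) w) (φ (next⁴ s) w) (φ (next⁵ s) w)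
      (+ k) (+ l₁) (+ l₂) (0≤+ l₁) (0≤+ l₂)
      (φ-next s v₁) (φ-opposite s v₁) (φ-opposite (next s) v₁) (φ-opposite (next² s) v₁)
      (φ-next s v₂)
      (φ-next s w) (φ-opposite s w) (φ-opposite (next s) w) (φ-opposite (next² s) w)
      e (into s) (into (next s)) (into (next² s))
      (walk-φ p₂ s) (walk-φ p₂ (next s)) (walk-φ p₂ (next² s))

tree-within : ∀ {v₁ v₂ k v m} → IsDist v₁ v₂ k → TreeThrough v₁ v₂ v m →
  k ≤ m × Within (m ∸ k) v₁ v₂ v
tree-within {v₁} {v₂} {k} {v} {m} d (vs , t , v₁∈ , v₂∈ , v∈)
  with w , l₁ , l₂ , l₃ , p₁ , p₂ , p₃ , l≤m ← tree⇒star t v₁∈ v₂∈ v∈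
  = k≤m , λ i → lemma (φ i v) (φ i w) (H v₁ v₂ i) (+ k) (+ (l₁ ℕ.+ l₂)) (+ l₃) (+ m) (+ (m ∸ k))
      (walk-φ p₃ i) (excess d p₁ p₂ i) (ℤ.+≤+ l≤m)
      (≡⇒≤ (cong +_ (sym (ℕ.m+[n∸m]≡n k≤m))))
  where
  -- The legs to `v₁` and `v₂` join into one walk; `k ≤ m` makes the truncated `m ∸ k` a true
  -- difference.
  k≤m : k ≤ m
  k≤m = ℕ.≤-trans (proj₂ d _ (walk-sym p₁ ++ʷ p₂)) (ℕ.≤-trans (ℕ.m≤m+n (l₁ ℕ.+ l₂) l₃) l≤m)
  lemma : ∀ a b h k l l₃ m c → a ≤ᶻ b + l₃ → k + b ≤ᶻ h + l → l + l₃ ≤ᶻ m → m ≤ᶻ k + c → a ≤ᶻ h + c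
  lemma a b h k l l₃ m c p q r s =
    linear (p ⊕ q ⊕ r ⊕ s) (solve (a ∷ b ∷ h ∷ k ∷ l ∷ l₃ ∷ m ∷ c ∷ []))

-- Tristance.

-- The tristance is `k` plus the least `c` with `Within c`, found by descending recursion;
-- `spanning-tree` attains this value and `tree-within` excludes smaller ones.
tristance : ∀ {v₁ v₂ k v} c → IsDist v₁ v₂ k → Within c v₁ v₂ v →
  ∃[ t ] (IsTristance v₁ v₂ v t × t ≤ k ℕ.+ c)
tristance {k = k} zero d p =
  let m , m≤k , t = spanning-tree d p
  in m , (t , λ _ t′ → ℕ.≤-trans m≤k
       (ℕ.≤-trans (ℕ.≤-reflexive (ℕ.+-identityʳ k)) (proj₁ (tree-within d t′)))) , m≤k
tristance {v₁} {v₂} {k} {v} (suc c) d p with Within? c v₁ v₂ v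
... | yes q =
  let m , t , m≤ = tristance c d q
  in m , t , ℕ.≤-trans m≤ (ℕ.+-monoʳ-≤ k (ℕ.n≤1+n c))
... | no ¬q =
  let m , m≤ , t = spanning-tree d p
  in m , (t , λ m′ t′ → ℕ.≤-trans m≤ (least m′ (tree-within d t′))) , m≤
  where
  least : ∀ m′ → k ≤ m′ × Within (m′ ∸ k) v₁ v₂ v → k ℕ.+ suc c ≤ m′
  least m′ (k≤m′ , q) = subst (k ℕ.+ suc c ≤_) (ℕ.m+[n∸m]≡n k≤m′)
    (ℕ.+-monoʳ-≤ k (ℕ.≰⇒> λ m′∸k≤c → ¬q (Within-mono {v₁ = v₁} {v₂} {v} m′∸k≤c q)))

-- Coordinate form and finiteness of the region.

InRegion⇒Within : ∀ c v₁ v₂ v → InRegion c v₁ v₂ v → Within c v₁ v₂ v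
InRegion⇒Within c v₁ v₂ v ((x≥ , x≤) , (y≥ , y≤) , (z≥ , z≤)) =
    cases x≤ z≤ (lower 5F y≥) (lower 0F x≥) (lower 1F z≥) y≤
  where
  lemma : ∀ m c x → m - c ≤ᶻ x → - x ≤ᶻ - m + c
  lemma m c x p = linear p (solve (m ∷ c ∷ x ∷ []))
  lower : ∀ i → (φ i v₁ ⊓ φ i v₂) - + c ≤ᶻ φ i v → φ (next³ i) v ≤ᶻ H v₁ v₂ (next³ i) + + c
  lower i p = subst₂ _≤ᶻ_ (sym (φ-opposite i v)) (cong (λ z → z + + c) (H-opposite-⊓ v₁ v₂ i))
    (lemma (φ i v₁ ⊓ φ i v₂) (+ c) (φ i v) p)

Within⇒InRegion : ∀ c v₁ v₂ v → Within c v₁ v₂ v → InRegion c v₁ v₂ v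
Within⇒InRegion c v₁ v₂ v p = (lower 0F , p 0F) , (lower 5F , p 5F) , (lower 1F , p 1F)
  where
  lemma : ∀ m c x → - x ≤ᶻ - m + c → m - c ≤ᶻ x
  lemma m c x p = linear p (solve (m ∷ c ∷ x ∷ []))
  lower : ∀ i → (φ i v₁ ⊓ φ i v₂) - + c ≤ᶻ φ i v
  lower i = lemma (φ i v₁ ⊓ φ i v₂) (+ c) (φ i v)
    (subst₂ _≤ᶻ_ (φ-opposite i v) (cong (λ z → z + + c) (sym (H-opposite-⊓ v₁ v₂ i))) (p (next³ i)))

-- Both ends are included, hence `suc`. Were `b` below `a`, the absolute value would only add
-- points, and `region` filters.
interval : ℤ → ℤ → List ℤ
interval a b = map (λ n → a + + n) (upTo (suc ∣ b - a ∣))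

interval-unique : ∀ a b → Unique (interval a b)
interval-unique a b = Unique.map⁺ (λ e → ℕ.≤-antisym
  (+-cancelˡ-≤ a (≡⇒≤ e)) (+-cancelˡ-≤ a (≡⇒≤ (sym e)))) (Unique.upTo⁺ _)

∈-interval : ∀ {a b x} → a ≤ᶻ x → x ≤ᶻ b → x ∈ interval a b
∈-interval {a} {b} {x} a≤x x≤b = at (≤⇒∃ a≤x)
  where
  b≡ : b ≡ a + + ∣ b - a ∣
  b≡ = proj₂ (≤⇒∃ (ℤ.≤-trans a≤x x≤b))
  at : (∃[ n ] x ≡ a + + n) → x ∈ interval a b
  at (n , refl) = ∈-map⁺ (λ n → a + + n) (∈-upTo⁺ (s≤s (+-cancelˡ-≤ a (subst (a + + n ≤ᶻ_) b≡ x≤b))))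

abscissae ordinates : ℕ → Pt → Pt → List ℤ
abscissae c v₁ v₂ = interval (- (H v₁ v₂ 3F + + c)) (H v₁ v₂ 0F + + c)
ordinates c v₁ v₂ = interval (- (H v₁ v₂ 2F + + c)) (H v₁ v₂ 5F + + c)

-- Four of the six directions bound the coordinates and give the box; the filter adds the two bounds
-- on `x - y`.
box region : ℕ → Pt → Pt → List Pt
box c v₁ v₂ = cartesianProduct (abscissae c v₁ v₂) (ordinates c v₁ v₂)
region c v₁ v₂ = filter (Within? c v₁ v₂) (box c v₁ v₂)

region-unique : ∀ c v₁ v₂ → Unique (region c v₁ v₂)
region-unique c v₁ v₂ = Unique.filter⁺ (Within? c v₁ v₂) {box c v₁ v₂}
  (Unique.cartesianProduct⁺ {xs = abscissae c v₁ v₂} {ordinates c v₁ v₂}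
    (interval-unique (- (H v₁ v₂ 3F + + c)) (H v₁ v₂ 0F + + c))
    (interval-unique (- (H v₁ v₂ 2F + + c)) (H v₁ v₂ 5F + + c)))

∈-region⁺ : ∀ {c v₁ v₂ v} → Within c v₁ v₂ v → v ∈ region c v₁ v₂
∈-region⁺ {c} {v₁} {v₂} {x , y} p = ∈-filter⁺ (Within? c v₁ v₂)
    (∈-cartesianProduct⁺ (∈-interval (lower x (p 3F)) (p 0F)) (∈-interval (lower y (p 2F)) (p 5F))) p
  where
  lower : ∀ z {h} → - z ≤ᶻ h → - h ≤ᶻ z
  lower z {h} q = subst (- h ≤ᶻ_) (ℤ.neg-involutive z) (ℤ.neg-mono-≤ q)

∈-region⁻ : ∀ {c v₁ v₂ v} → v ∈ region c v₁ v₂ → Within c v₁ v₂ v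
∈-region⁻ {c} {v₁} {v₂} v∈ = proj₂ (∈-filter⁻ (Within? c v₁ v₂) {xs = box c v₁ v₂} v∈)

-- Counting and optimality.

lookup-injective : ∀ {A : Set} {xs : List A} → Unique xs → ∀ {i j} → lookup xs i ≡ lookup xs j → i ≡ j
lookup-injective (_ ∷ _) {zero} {zero} _ = refl
lookup-injective (x≢ ∷ _) {zero} {suc j} e = ⊥-elim (All.lookup x≢ (∈-lookup j) e)
lookup-injective (x≢ ∷ _) {suc i} {zero} e = ⊥-elim (All.lookup x≢ (∈-lookup i) (sym e))
lookup-injective (_ ∷ u) {suc i} {suc j} e = cong suc (lookup-injective u e)

-- Pigeonhole: sending a position in `xs` to that of the same element in `ys` is injective.
unique⇒length-mono-≤ : ∀ {A : Set} {xs ys : List A} → Unique xs → xs ⊆ ys → length xs ≤ length ys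
unique⇒length-mono-≤ {xs = xs} {ys} u xs⊆ys = injective⇒≤ {f = λ i → index (position i)}
    λ {i} {j} e → lookup-injective u (trans (lookup-index (position i))
      (trans (cong (lookup ys) e) (sym (lookup-index (position j)))))
  where
  position : ∀ i → lookup xs i ∈ ys
  position i = xs⊆ys (∈-lookup i)

anticode⊆region : ∀ {v₁ v₂ k d A} → IsDist v₁ v₂ k → IsAnticode d v₁ v₂ A → A ⊆ region (d ∸ k) v₁ v₂
anticode⊆region {v₁} {v₂} {k} dist (_ , all) {v} v∈ =
  let t , (through , _) , t≤d = All.lookup all v∈
  in ∈-region⁺ (Within-mono {v₁ = v₁} {v₂} {v} (ℕ.∸-monoˡ-≤ k t≤d) (proj₂ (tree-within dist through)))

region-anticode : ∀ {v₁ v₂ k d} → IsDist v₁ v₂ k → k ≤ d → IsAnticode d v₁ v₂ (region (d ∸ k) v₁ v₂)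
region-anticode {v₁} {v₂} {k} {d} dist k≤d = region-unique (d ∸ k) v₁ v₂ , All.tabulate λ v∈ →
  let t , is , t≤ = tristance (d ∸ k) dist (∈-region⁻ v∈)
  in t , is , ℕ.≤-trans t≤ (ℕ.≤-reflexive (ℕ.m+[n∸m]≡n k≤d))

region⊆optimal : ∀ {v₁ v₂ k d A} → IsDist v₁ v₂ k → k ≤ d → IsOptimalAnticode d v₁ v₂ A →
  region (d ∸ k) v₁ v₂ ⊆ A
region⊆optimal {v₁} {v₂} {k} {d} {A} dist k≤d (anti , largest) {v} v∈ with v ∈? A
... | yes v∈A = v∈A
-- Otherwise `v ∷ A` is duplicate-free inside the region, so the region is an anticode longer than
-- `A`.
... | no v∉A = ⊥-elim (ℕ.<⇒≱
    (unique⇒length-mono-≤ (¬Any⇒All¬ A v∉A ∷ proj₁ anti) v∷A⊆region)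
    (largest (region (d ∸ k) v₁ v₂) (region-anticode dist k≤d)))
  where
  v∷A⊆region : (v ∷ A) ⊆ region (d ∸ k) v₁ v₂
  v∷A⊆region (here refl) = v∈
  v∷A⊆region (there x∈) = anticode⊆region dist anti x∈

theorem24 : (v₁ v₂ : Pt) → v₁ ≢ v₂ → (k d : ℕ) → IsDist v₁ v₂ k → k ≤ d →
    (∃[ A ] IsOptimalAnticode d v₁ v₂ A) ×
    ((A : List Pt) → IsOptimalAnticode d v₁ v₂ A →
    (v : Pt) → (v ∈ A ⇔ InRegion (d ∸ k) v₁ v₂ v))
theorem24 v₁ v₂ _ k d dist k≤d =
    (region (d ∸ k) v₁ v₂ , region-anticode dist k≤d ,
      λ B anti → unique⇒length-mono-≤ (proj₁ anti) (anticode⊆region dist anti))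
  , λ A opt v → mk⇔
      (λ v∈ → Within⇒InRegion (d ∸ k) v₁ v₂ v (∈-region⁻ (anticode⊆region dist (proj₁ opt) v∈)))
      (λ p → region⊆optimal dist k≤d opt (∈-region⁺ (InRegion⇒Within (d ∸ k) v₁ v₂ v p)))
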